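{- Let $G$ be any graph with $r$ vertices and $m$ edges. Let $S$ be a set of positive integers with $|S|=m+2$. Then any $S$-partial labeling of $G$ that satisfies the property that no more than $\lceil r/2\rceil$ vertices have the same positive weight has a completion that also satisfies this property.
   Context: All graphs are finite, undirected and simple. For a graph $G=(V,E)$ and a set $S$ of positive integers, an $S$-partial labeling of $G$ is an assignment of distinct labels from $S$ to some of the edges of $G$ ($|S|>|E|$ is allowed). Given a partial labeling, the weight of a vertex $v$ is the sum of the labels of those edges incident with $v$ that received a label. A completion of an $S$-partial labeling is an assignment of distinct unused labels from $S$ to all the remaining non-labeled edges of $G$.
   Formalization: The graph with two vertices and one edge is excluded: there the empty partial labeling has the property, but every completion gives both vertices the same positive weight, and 2 > ⌈2/2⌉ = 1. -}

module Defs where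

open import Data.Nat using (ℕ; _≤_; _<_; _≟_; ⌈_/2⌉)
open import Data.Nat.ListAction using (sum)
open import Data.Fin using (Fin)
open import Data.Fin.Subset using (Subset; ∣_∣)
open import Data.Fin.Subset.Properties using (_∈?_)
open import Data.List using (List; length; filter; mapMaybe; allFin)
open import Data.List.Membership.Propositional using () renaming (_∈_ to _∈ₗ_)
open import Data.Maybe using (Maybe; just; nothing)
open import Data.Product using (_×_)
open import Function.Definitions using (Injective)
open import Relation.Binary.PropositionalEquality using (_≡_; _≢_)

-- A finite simple graph with vertex set Fin r whose edge set, a set of m
-- two-element subsets of Fin r, is enumerated without repetition by Fin m.
record Graph (r m : ℕ) : Set where
  field
    edge      : Fin m → Subset r
    two-ends  : ∀ e → ∣ edge e ∣ ≡ 2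
    distinctᴱ : Injective _≡_ _≡_ edge

-- A simple graph with two vertices and one edge is K₂. There the empty labeling
-- gives no vertex positive weight, while every completion gives both vertices
-- the same positive weight, and 2 > ⌈ 2 /2⌉; so K₂ must be excluded.
IsK₂ : ∀ {r m} → Graph r m → Set
IsK₂ {r} {m} _ = r ≡ 2 × m ≡ 1

-- The finite label set S is a list, assumed duplicate-free where its cardinality
-- matters; nothing marks an edge without a label.
record IsPartialLabeling {m : ℕ} (S : List ℕ) (f : Fin m → Maybe ℕ) : Set where
  field
    from-S   : ∀ e l → f e ≡ just l → l ∈ₗ S
    distinct : ∀ e e′ l → f e ≡ just l → f e′ ≡ just l → e ≡ e′

record IsCompletion {m : ℕ} (S : List ℕ) (f : Fin m → Maybe ℕ)
                    (g : Fin m → ℕ) : Set where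
  field
    extends  : ∀ e l → f e ≡ just l → g e ≡ l
    from-S   : ∀ e → f e ≡ nothing → g e ∈ₗ S
    unused   : ∀ e → f e ≡ nothing → ∀ e′ → f e′ ≢ just (g e)
    distinct : ∀ e e′ → f e ≡ nothing → f e′ ≡ nothing → g e ≡ g e′ → e ≡ e′

module _ {r m : ℕ} (G : Graph r m) where
  open Graph G

  weight : (Fin m → Maybe ℕ) → Fin r → ℕ
  weight f v = sum (mapMaybe f (filter (λ e → v ∈? edge e) (allFin m)))

  -- No more than ⌈ r /2⌉ vertices have the same positive weight.
  Balanced : (Fin m → Maybe ℕ) → Set
  Balanced f = ∀ w → 0 < w →
    length (filter (λ v → weight f v ≟ w) (allFin r)) ≤ ⌈ r /2⌉

{-# OPTIONS --safe #-}
-- Label the unlabeled edges one at a time. Before each step at least three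
-- labels are unused, and for the edge uv at most two of them destroy balance.
-- Let h = ⌈ r /2⌉. A label ℓ is bad only if the class of weight ℓ + wt u or
-- ℓ + wt v becomes too large. If u and v have different weights, that requires
-- h vertices other than u and v of the same weight; only one weight can be so
-- frequent among r − 2 vertices, and it rules out one label for each of u, v.
-- If u and v have equal weights, it requires h − 1 such vertices; three weights
-- cannot be so frequent when r ≥ 3.
module Submission where

open import Data.Nat using (ℕ; zero; suc; _+_; _<_; _≤_; _≟_; _≤?_; z≤n; s≤s; s≤s⁻¹; ⌈_/2⌉)
open import Data.Nat.Properties
  using (≤-reflexive; ≤-trans; n≮n; +-mono-≤; +-monoˡ-≤; +-cancelˡ-≤;
         +-cancelʳ-≤; +-cancelˡ-≡; +-cancelʳ-≡; m≤n+m; ≰⇒>; suc-injective; ⌈n/2⌉-mono; ⌊n/2⌋≤⌈n/2⌉; ⌊n/2⌋+⌈n/2⌉≡n;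
         module ≤-Reasoning)
open import Data.Nat.ListAction using (sum)
open import Data.Nat.Tactic.RingSolver using (solve-∀)
open import Data.Fin using (Fin; zero; suc)
import Data.Fin as Fin
import Data.Fin.Properties as Fin
open import Data.Fin.Subset using (Subset; ∣_∣; inside; outside; _∈_)
open import Data.Fin.Subset.Properties
  using (_∈?_; ∣p∣≤n; ∣p∣≡n⇒p≡⊤)
open import Data.List using (List; []; _∷_; _++_; length; filter; mapMaybe; concatMap; map; allFin)
open import Data.List.Properties using (length-++; length-removeAt′; length-mapMaybe; length-tabulate; mapMaybe-cong)
open import Data.List.Membership.Propositional using (_∉_; find) renaming (_∈_ to _∈ₗ_)
open import Data.List.Membership.Propositional.Properties using (∈-filter⁺; ∈-filter⁻; ∈-allFin; ∈-++⁺ˡ; ∈-++⁺ʳ; ∈-concatMap⁻)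
open import Data.List.Relation.Binary.Subset.Propositional using (_⊆_)
open import Data.List.Relation.Unary.All using (All; []; _∷_)
import Data.List.Relation.Unary.All as All
import Data.List.Relation.Unary.All.Properties as All
open import Data.List.Relation.Unary.AllPairs using ([]; _∷_)
import Data.List.Relation.Unary.AllPairs as AllPairs
import Data.List.Relation.Unary.AllPairs.Properties as AllPairs
open import Data.List.Relation.Unary.Any using (here; there; any?; _─_; index; satisfied)
open import Data.List.Relation.Unary.Unique.Propositional using (Unique)
import Data.List.Relation.Unary.Unique.Propositional.Properties as Unique
open import Data.Maybe using (Maybe; just; nothing)
open import Data.Maybe.Properties using (just-injective)
open import Data.Product using (Σ; ∃; ∃₂; _×_; _,_; proj₁; proj₂)
import Data.Sum as Sum
open import Data.Sum using (_⊎_; inj₁; inj₂)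
open import Data.Vec using ([]; _∷_; here; there)
open import Data.Vec.Functional using (updateAt)
open import Data.Vec.Functional.Properties using (updateAt-updates; updateAt-minimal)
open import Function using (_∘_; const; case_of_)
open import Relation.Nullary using (¬_; yes; no; contradiction; ¬?; _×-dec_)
open import Relation.Unary using (Decidable)
open import Relation.Binary.PropositionalEquality
  using (_≡_; _≢_; refl; sym; trans; cong; subst; ≢-sym)
open import Data.List.Membership.DecPropositional _≟_ using () renaming (_∈?_ to _∈ₗ?_)
open import Defs

module _ {A : Set} where

  ∈-─⁺ : ∀ {x y : A} {xs} (x∈xs : x ∈ₗ xs) → y ∈ₗ xs → y ≢ x → y ∈ₗ (xs ─ x∈xs)
  ∈-─⁺ (here refl)  (here refl)  y≢x = contradiction refl y≢x
  ∈-─⁺ (here refl)  (there y∈xs) y≢x = y∈xs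
  ∈-─⁺ (there x∈xs) (here refl)  y≢x = here refl
  ∈-─⁺ (there x∈xs) (there y∈xs) y≢x = there (∈-─⁺ x∈xs y∈xs y≢x)

  length-concatMap : ∀ {B : Set} (f : A → List B) xs →
    length (concatMap f xs) ≡ sum (map (length ∘ f) xs)
  length-concatMap f []       = refl
  length-concatMap f (x ∷ xs) = trans (length-++ (f x)) (cong (length (f x) +_) (length-concatMap f xs))

  Unique-⊆⇒length≤ : ∀ {xs ys : List A} → Unique xs → xs ⊆ ys → length xs ≤ length ys
  Unique-⊆⇒length≤ [] _ = z≤n
  Unique-⊆⇒length≤ {x ∷ xs} {ys} (x∉xs ∷ xs!) xs⊆ys = begin
    suc (length xs)          ≤⟨ s≤s (Unique-⊆⇒length≤ xs! λ y∈xs →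
                                 ∈-─⁺ x∈ys (xs⊆ys (there y∈xs)) (≢-sym (All.lookup x∉xs y∈xs))) ⟩
    suc (length (ys ─ x∈ys)) ≡⟨ length-removeAt′ ys (index x∈ys) ⟨
    length ys                ∎
    where
    open ≤-Reasoning
    x∈ys = xs⊆ys (here refl)

Unique-Fin⇒length≤ : ∀ {n} {xs : List (Fin n)} → Unique xs → length xs ≤ n
Unique-Fin⇒length≤ {n} xs! =
  ≤-trans (Unique-⊆⇒length≤ xs! (λ {x} _ → ∈-allFin x)) (≤-reflexive (length-tabulate {n = n} _))

∣p∣≡0⇒x∉p : ∀ {n} {p : Subset n} {x} → ∣ p ∣ ≡ 0 → ¬ x ∈ p
∣p∣≡0⇒x∉p {p = inside ∷ _}  ()
∣p∣≡0⇒x∉p {p = outside ∷ _} ∣p∣≡0 (there x∈p) = ∣p∣≡0⇒x∉p ∣p∣≡0 x∈p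

∣p∣≡1⇒singleton : ∀ {n} {p : Subset n} → ∣ p ∣ ≡ 1 → ∃ λ x → x ∈ p × (∀ {y} → y ∈ p → y ≡ x)
∣p∣≡1⇒singleton {p = inside ∷ p} ∣p∣≡1 = zero , here , λ where
  here        → refl
  (there y∈p) → contradiction y∈p (∣p∣≡0⇒x∉p (suc-injective ∣p∣≡1))
∣p∣≡1⇒singleton {p = outside ∷ p} ∣p∣≡1 with ∣p∣≡1⇒singleton {p = p} ∣p∣≡1
... | x , x∈p , only = suc x , there x∈p , λ where (there y∈p) → cong suc (only y∈p)

∣p∣≡2⇒pair : ∀ {n} {p : Subset n} → ∣ p ∣ ≡ 2 →
  ∃₂ λ x y → x ≢ y × x ∈ p × y ∈ p × (∀ {z} → z ∈ p → z ≡ x ⊎ z ≡ y)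
∣p∣≡2⇒pair {p = inside ∷ p} ∣p∣≡2 with ∣p∣≡1⇒singleton {p = p} (suc-injective ∣p∣≡2)
... | y , y∈p , only = zero , suc y , (λ ()) , here , there y∈p , λ where
  here        → inj₁ refl
  (there z∈p) → inj₂ (cong suc (only z∈p))
∣p∣≡2⇒pair {p = outside ∷ p} ∣p∣≡2 with ∣p∣≡2⇒pair {p = p} ∣p∣≡2
... | x , y , x≢y , x∈p , y∈p , only =
  suc x , suc y , x≢y ∘ Fin.suc-injective , there x∈p , there y∈p , λ where
    (there z∈p) → Sum.map (cong suc) (cong suc) (only z∈p)

edge⇒3≤r : ∀ {r m} (G : Graph r m) → ¬ IsK₂ G → Fin m → 3 ≤ r
edge⇒3≤r {r} {m} G ¬K₂ e = bound G ¬K₂ e (subst (_≤ r) (two-ends e) (∣p∣≤n (edge e)))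
  where
  open Graph G
  bound : ∀ {r m} (G : Graph r m) → ¬ IsK₂ G → Fin m → 2 ≤ r → 3 ≤ r
  bound {suc (suc (suc _))}            _ _   _ _ = s≤s (s≤s (s≤s z≤n))
  bound {suc (suc zero)} {suc zero}    _ ¬K₂ _ _ = contradiction (refl , refl) ¬K₂
  bound {suc (suc zero)} {suc (suc _)} G _   _ _
    with () ← Graph.distinctᴱ G {zero} {suc zero}
                (trans (∣p∣≡n⇒p≡⊤ (Graph.two-ends G zero)) (sym (∣p∣≡n⇒p≡⊤ (Graph.two-ends G (suc zero)))))
  bound {suc zero} _ _ _ (s≤s ())

relabel : ∀ {m} → (Fin m → Maybe ℕ) → Fin m → ℕ → Fin m → Maybe ℕ
relabel f e ℓ = updateAt f e (const (just ℓ))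

module _ {m : ℕ} (f : Fin m → Maybe ℕ) {e : Fin m} (fe : f e ≡ nothing) where

  length-mapMaybe-< : ∀ {es} → e ∈ₗ es → length (mapMaybe f es) < length es
  length-mapMaybe-< {e ∷ es} (here refl) rewrite fe = s≤s (length-mapMaybe f es)
  length-mapMaybe-< {e′ ∷ _} (there e∈es) with f e′
  ... | just _  = s≤s (length-mapMaybe-< e∈es)
  ... | nothing = ≤-trans (length-mapMaybe-< e∈es) (m≤n+m _ 1)

  module _ (ℓ : ℕ) where

    mapMaybe-relabel-∉ : ∀ {es} → All (e ≢_) es → mapMaybe (relabel f e ℓ) es ≡ mapMaybe f es
    mapMaybe-relabel-∉ [] = refl
    mapMaybe-relabel-∉ {e′ ∷ _} (e≢e′ ∷ e∉es)
      rewrite updateAt-minimal e′ e {const (just ℓ)} f (≢-sym e≢e′) with f e′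
    ... | just l  = cong (l ∷_) (mapMaybe-relabel-∉ e∉es)
    ... | nothing = mapMaybe-relabel-∉ e∉es

    sum-relabel-∈ : ∀ {es} → Unique es → e ∈ₗ es →
      sum (mapMaybe (relabel f e ℓ) es) ≡ ℓ + sum (mapMaybe f es)
    sum-relabel-∈ (e∉es ∷ _) (here refl)
      rewrite updateAt-updates e {const (just ℓ)} f | fe = cong (λ ls → ℓ + sum ls) (mapMaybe-relabel-∉ e∉es)
    sum-relabel-∈ {e′ ∷ es} (e′∉es ∷ es!) (there e∈es)
      rewrite updateAt-minimal e′ e {const (just ℓ)} f (All.lookup e′∉es e∈es) with f e′
    ... | just l  = trans (cong (l +_) (sum-relabel-∈ es! e∈es)) (swap l ℓ _)
      where
      swap : ∀ a b c → a + (b + c) ≡ b + (a + c)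
      swap = solve-∀
    ... | nothing = sum-relabel-∈ es! e∈es

module _ {r : ℕ} where

  class : (Fin r → ℕ) → ℕ → List (Fin r)
  class wt w = filter (λ x → wt x ≟ w) (allFin r)

  class-! : ∀ wt w → Unique (class wt w)
  class-! wt w = Unique.filter⁺ _ (Unique.allFin⁺ r)

  module _ (wt : Fin r → ℕ) {u v : Fin r} (u≢v : u ≢ v) where

    private
      h = ⌈ r /2⌉

      r≤h+h : r ≤ h + h
      r≤h+h = subst (_≤ h + h) (⌊n/2⌋+⌈n/2⌉≡n r) (+-monoˡ-≤ h (⌊n/2⌋≤⌈n/2⌉ r))

    Rest : ℕ → Fin r → Set
    Rest w x = (u ≢ x × v ≢ x) × wt x ≡ w

    rest? : ∀ w → Decidable (Rest w)
    rest? w x = (¬? (u Fin.≟ x) ×-dec ¬? (v Fin.≟ x)) ×-dec (wt x ≟ w)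

    rest : ℕ → List (Fin r)
    rest w = filter (rest? w) (allFin r)

    ∈-rest⁻ : ∀ {w x} → x ∈ₗ rest w → Rest w x
    ∈-rest⁻ {w} = proj₂ ∘ ∈-filter⁻ (rest? w) {xs = allFin r}

    ∈-rest⁺ : ∀ {w x} → Rest w x → x ∈ₗ rest w
    ∈-rest⁺ {w} = ∈-filter⁺ (rest? w) (∈-allFin _)

    rests-fit : ∀ {ws} → Unique ws → 2 + sum (map (length ∘ rest) ws) ≤ r
    rests-fit {ws} ws! = subst (λ n → 2 + n ≤ r) (length-concatMap rest ws) (Unique-Fin⇒length≤
      ((u≢v ∷ All.tabulate (proj₁ ∘ outside-uv)) ∷ All.tabulate (proj₂ ∘ outside-uv) ∷ rests-!))
      where
      outside-uv : ∀ {x} → x ∈ₗ concatMap rest ws → u ≢ x × v ≢ x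
      outside-uv x∈ with satisfied (∈-concatMap⁻ rest {xs = ws} x∈)
      ... | w , x∈w = proj₁ (∈-rest⁻ x∈w)
      rests-! : Unique (concatMap rest ws)
      rests-! = Unique.concat⁺
        (All.map⁺ (All.universal (λ w → Unique.filter⁺ (rest? w) (Unique.allFin⁺ r)) ws))
        (AllPairs.map⁺ (AllPairs.map (λ w≢w′ {_} (x∈ , x∈′) →
          w≢w′ (trans (sym (proj₂ (∈-rest⁻ x∈))) (proj₂ (∈-rest⁻ x∈′)))) ws!))

    -- k is the number of ends of the edge uv that can enter one and the same weight class.
    Roomy : ℕ → ℕ → Set
    Roomy k w = k + length (rest w) ≤ h

    Good : ℕ → ℕ → Set
    Good k ℓ = Roomy k (ℓ + wt u) × Roomy k (ℓ + wt v)

    good? : ∀ k → Decidable (Good k)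
    good? k ℓ = (_ ≤? h) ×-dec (_ ≤? h)

    ¬Good⇒ : ∀ {k ℓ} → ¬ Good k ℓ → ¬ Roomy k (ℓ + wt u) ⊎ ¬ Roomy k (ℓ + wt v)
    ¬Good⇒ {k} {ℓ} bad with k + length (rest (ℓ + wt u)) ≤? h
    ... | yes roomy = inj₂ λ roomy′ → bad (roomy , roomy′)
    ... | no ¬roomy = inj₁ ¬roomy

    crowded₁-unique : ∀ {p q} → ¬ Roomy 1 p → ¬ Roomy 1 q → p ≡ q
    crowded₁-unique {p} {q} ¬P ¬Q with p ≟ q
    ... | yes p≡q = p≡q
    ... | no  p≢q = contradiction (begin-strict
      h + h                                      ≤⟨ +-mono-≤ (s≤s⁻¹ (≰⇒> ¬P)) (s≤s⁻¹ (≰⇒> ¬Q)) ⟩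
      length (rest p) + length (rest q)          <⟨ m≤n+m _ 1 ⟩
      2 + (length (rest p) + length (rest q))    ≡⟨ pad (length (rest p)) (length (rest q)) ⟩
      2 + sum (map (length ∘ rest) (p ∷ q ∷ [])) ≤⟨ rests-fit ((p≢q ∷ []) ∷ [] ∷ []) ⟩
      r                                          ≤⟨ r≤h+h ⟩
      h + h                                      ∎) (n≮n _)
      where
      open ≤-Reasoning
      pad : ∀ a b → 2 + (a + b) ≡ 2 + (a + (b + 0))
      pad = solve-∀

    ¬three-crowded₂ : 3 ≤ r → ∀ {p q s} → p ≢ q → p ≢ s → q ≢ s →
      ¬ Roomy 2 p → ¬ Roomy 2 q → ¬ ¬ Roomy 2 s
    ¬three-crowded₂ 3≤r {p} {q} {s} p≢q p≢s q≢s ¬P ¬Q ¬S =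
      contradiction (≤-trans (⌈n/2⌉-mono 3≤r) (+-cancelʳ-≤ (h + h) h 1 (begin
        h + (h + h)                   ≤⟨ +-mono-≤ (s≤s⁻¹ (≰⇒> ¬P)) (+-mono-≤ (s≤s⁻¹ (≰⇒> ¬Q)) (s≤s⁻¹ (≰⇒> ¬S))) ⟩
        suc a + (suc b + suc c)       ≡⟨ pad a b c ⟩
        1 + (2 + (a + (b + (c + 0)))) ≤⟨ s≤s (rests-fit ((p≢q ∷ p≢s ∷ []) ∷ (q≢s ∷ []) ∷ [] ∷ [])) ⟩
        1 + r                         ≤⟨ s≤s r≤h+h ⟩
        1 + (h + h)                   ∎))) (n≮n 1)
      where
      open ≤-Reasoning
      a = length (rest p)
      b = length (rest q)
      c = length (rest s)
      pad : ∀ a b c → suc a + (suc b + suc c) ≡ 1 + (2 + (a + (b + (c + 0))))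
      pad = solve-∀

    private
      cancel : ∀ {ℓ ℓ′} n → ℓ + n ≡ ℓ′ + n → ℓ ≡ ℓ′
      cancel {ℓ} {ℓ′} n = +-cancelʳ-≡ n ℓ ℓ′

    ¬all-bad₁ : ∀ {a b c} → a ≢ b → a ≢ c → b ≢ c → ¬ Good 1 a → ¬ Good 1 b → ¬ ¬ Good 1 c
    ¬all-bad₁ {a} {b} {c} a≢b a≢c b≢c ¬A ¬B ¬C with ¬Good⇒ {1} {a} ¬A | ¬Good⇒ {1} {b} ¬B | ¬Good⇒ {1} {c} ¬C
    ... | inj₁ A | inj₁ B | _      = a≢b (cancel (wt u) (crowded₁-unique A B))
    ... | inj₂ A | inj₂ B | _      = a≢b (cancel (wt v) (crowded₁-unique A B))
    ... | inj₁ A | inj₂ _ | inj₁ C = a≢c (cancel (wt u) (crowded₁-unique A C))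
    ... | inj₂ A | inj₁ _ | inj₂ C = a≢c (cancel (wt v) (crowded₁-unique A C))
    ... | inj₁ _ | inj₂ B | inj₂ C = b≢c (cancel (wt v) (crowded₁-unique B C))
    ... | inj₂ _ | inj₁ B | inj₁ C = b≢c (cancel (wt u) (crowded₁-unique B C))

    ¬all-bad₂ : 3 ≤ r → wt u ≡ wt v →
      ∀ {a b c} → a ≢ b → a ≢ c → b ≢ c → ¬ Good 2 a → ¬ Good 2 b → ¬ ¬ Good 2 c
    ¬all-bad₂ 3≤r wu≡wv a≢b a≢c b≢c ¬A ¬B ¬C =
      ¬three-crowded₂ 3≤r (a≢b ∘ cancel (wt u)) (a≢c ∘ cancel (wt u)) (b≢c ∘ cancel (wt u))
        (crowded ¬A) (crowded ¬B) (crowded ¬C)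
      where
      crowded : ∀ {ℓ} → ¬ Good 2 ℓ → ¬ Roomy 2 (ℓ + wt u)
      crowded {ℓ} bad roomy = bad (roomy , subst (λ n → Roomy 2 (ℓ + n)) wu≡wv roomy)

    record Bumped (ℓ : ℕ) (wt′ : Fin r → ℕ) : Set where
      field
        at-u      : wt′ u ≡ ℓ + wt u
        at-v      : wt′ v ≡ ℓ + wt v
        elsewhere : ∀ {x} → u ≢ x → v ≢ x → wt′ x ≡ wt x

    module _ {ℓ wt′} (bumped : Bumped ℓ wt′) where
      open Bumped bumped

      class-bumped : ∀ {w x} → x ∈ₗ class wt′ w →
        (x ≡ u × w ≡ ℓ + wt u) ⊎ (x ≡ v × w ≡ ℓ + wt v) ⊎ x ∈ₗ rest w
      class-bumped {w} {x} x∈ with proj₂ (∈-filter⁻ (λ x → wt′ x ≟ w) {xs = allFin r} x∈) | u Fin.≟ x | v Fin.≟ x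
      ... | refl | yes refl | _        = inj₁ (refl , at-u)
      ... | refl | no _     | yes refl = inj₂ (inj₁ (refl , at-v))
      ... | refl | no u≢x   | no v≢x   = inj₂ (inj₂ (∈-rest⁺ ((u≢x , v≢x) , sym (elsewhere u≢x v≢x))))

      length-class₂ : ∀ w → length (class wt′ w) ≤ 2 + length (rest w)
      length-class₂ w = Unique-⊆⇒length≤ {ys = u ∷ v ∷ rest w} (class-! wt′ w) λ x∈ → case class-bumped x∈ of λ where
        (inj₁ (refl , _))        → here refl
        (inj₂ (inj₁ (refl , _))) → there (here refl)
        (inj₂ (inj₂ x∈rest))     → there (there x∈rest)

      length-class₁ : wt u ≢ wt v → ∀ w → length (class wt′ w) ≤ 1 + length (rest w)
      length-class₁ wu≢wv w with w ≟ ℓ + wt u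
      ... | yes refl = Unique-⊆⇒length≤ {ys = u ∷ rest w} (class-! wt′ w) λ x∈ → case class-bumped x∈ of λ where
        (inj₁ (refl , _))      → here refl
        (inj₂ (inj₁ (_ , eq))) → contradiction (+-cancelˡ-≡ ℓ _ _ eq) wu≢wv
        (inj₂ (inj₂ x∈rest))   → there x∈rest
      ... | no w≢ = Unique-⊆⇒length≤ {ys = v ∷ rest w} (class-! wt′ w) λ x∈ → case class-bumped x∈ of λ where
        (inj₁ (_ , eq))          → contradiction eq w≢
        (inj₂ (inj₁ (refl , _))) → here refl
        (inj₂ (inj₂ x∈rest))     → there x∈rest

      Good⇒bounded : ∀ {k} → (∀ w → length (class wt′ w) ≤ k + length (rest w)) → Good k ℓ →
        ∀ w → length (class wt w) ≤ h → length (class wt′ w) ≤ h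
      Good⇒bounded class≤ (roomy-u , roomy-v) w bounded with w ≟ ℓ + wt u | w ≟ ℓ + wt v
      ... | yes refl | _        = ≤-trans (class≤ w) roomy-u
      ... | no _     | yes refl = ≤-trans (class≤ w) roomy-v
      ... | no w≢u   | no w≢v   = ≤-trans (Unique-⊆⇒length≤ (class-! wt′ w) class′⊆class) bounded
        where
        class′⊆class : class wt′ w ⊆ class wt w
        class′⊆class x∈ with class-bumped x∈
        ... | inj₁ (_ , eq)        = contradiction eq w≢u
        ... | inj₂ (inj₁ (_ , eq)) = contradiction eq w≢v
        ... | inj₂ (inj₂ x∈rest)   = ∈-filter⁺ _ (∈-allFin _) (proj₂ (∈-rest⁻ x∈rest))

    Safe : ℕ → Set
    Safe ℓ = ∀ {wt′} → Bumped ℓ wt′ → ∀ w → length (class wt w) ≤ h → length (class wt′ w) ≤ h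

    safe-label : 3 ≤ r → ∀ {ls} → Unique ls → 3 ≤ length ls → ∃ λ ℓ → ℓ ∈ₗ ls × Safe ℓ
    safe-label 3≤r {a ∷ b ∷ c ∷ ls} ((a≢b ∷ a≢c ∷ _) ∷ (b≢c ∷ _) ∷ _) _ with wt u ≟ wt v
    ... | yes wu≡wv with any? (good? 2) (a ∷ b ∷ c ∷ ls)
    ...   | yes good = let ℓ , ℓ∈ , g = find good in ℓ , ℓ∈ , λ β → Good⇒bounded β (length-class₂ β) g
    ...   | no ¬good with ¬A ∷ ¬B ∷ ¬C ∷ _ ← All.¬Any⇒All¬ _ ¬good =
      contradiction ¬C (¬all-bad₂ 3≤r wu≡wv a≢b a≢c b≢c ¬A ¬B)
    safe-label 3≤r {a ∷ b ∷ c ∷ ls} ((a≢b ∷ a≢c ∷ _) ∷ (b≢c ∷ _) ∷ _) _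
        | no wu≢wv with any? (good? 1) (a ∷ b ∷ c ∷ ls)
    ...   | yes good = let ℓ , ℓ∈ , g = find good in ℓ , ℓ∈ , λ β → Good⇒bounded β (length-class₁ β wu≢wv) g
    ...   | no ¬good with ¬A ∷ ¬B ∷ ¬C ∷ _ ← All.¬Any⇒All¬ _ ¬good =
      contradiction ¬C (¬all-bad₁ a≢b a≢c b≢c ¬A ¬B)
    safe-label _ {a ∷ b ∷ []} _ (s≤s (s≤s ()))
    safe-label _ {a ∷ []}     _ (s≤s ())

_⊑_ : ∀ {m} → (f g : Fin m → Maybe ℕ) → Set
f ⊑ g = ∀ {e l} → f e ≡ just l → g e ≡ just l

used : ∀ {m} → (Fin m → Maybe ℕ) → List ℕ
used {m} f = mapMaybe f (allFin m)

∈-mapMaybe⁺ : ∀ {A B : Set} {f : A → Maybe B} {x y xs} → x ∈ₗ xs → f x ≡ just y → y ∈ₗ mapMaybe f xs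
∈-mapMaybe⁺ (here refl) fx rewrite fx = here refl
∈-mapMaybe⁺ {f = f} {xs = x′ ∷ _} (there x∈xs) fx with f x′
... | just _  = there (∈-mapMaybe⁺ x∈xs fx)
... | nothing = ∈-mapMaybe⁺ x∈xs fx

module _ {m : ℕ} (S : List ℕ) (f : Fin m → Maybe ℕ) where

  unused : List ℕ
  unused = filter (λ l → ¬? (l ∈ₗ? used f)) S

  unused-! : Unique S → Unique unused
  unused-! = Unique.filter⁺ _

  ∈-unused⁻ : ∀ {l} → l ∈ₗ unused → l ∈ₗ S × l ∉ used f
  ∈-unused⁻ = ∈-filter⁻ _ {xs = S}

  3≤length-unused : Unique S → length S ≡ m + 2 → ∀ {e} → f e ≡ nothing → 3 ≤ length unused
  3≤length-unused S! ∣S∣ {e} fe = +-cancelˡ-≤ m 3 _ (begin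
    m + 3                                 ≡⟨ shift m ⟩
    suc (m + 2)                           ≡⟨ cong suc ∣S∣ ⟨
    suc (length S)                        ≤⟨ s≤s (Unique-⊆⇒length≤ S! S⊆) ⟩
    suc (length (used f ++ unused))       ≡⟨ cong suc (length-++ (used f)) ⟩
    suc (length (used f)) + length unused ≤⟨ +-monoˡ-≤ _ (length-mapMaybe-< f fe (∈-allFin e)) ⟩
    length (allFin m) + length unused     ≡⟨ cong (_+ length unused) (length-tabulate {n = m} _) ⟩
    m + length unused                     ∎)
    where
    open ≤-Reasoning
    shift : ∀ m → m + 3 ≡ suc (m + 2)
    shift = solve-∀
    S⊆ : S ⊆ used f ++ unused
    S⊆ {l} l∈S with l ∈ₗ? used f
    ... | yes l∈used = ∈-++⁺ˡ l∈used
    ... | no  l∉used = ∈-++⁺ʳ (used f) (∈-filter⁺ _ l∈S l∉used)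

module _ {m : ℕ} {f : Fin m → Maybe ℕ} {e : Fin m} (ℓ : ℕ) where

  relabel-e : relabel f e ℓ e ≡ just ℓ
  relabel-e = updateAt-updates e f

  relabel-≢ : ∀ {e′} → e′ ≢ e → relabel f e ℓ e′ ≡ f e′
  relabel-≢ {e′} = updateAt-minimal e′ e f

  ⊑-relabel : f e ≡ nothing → f ⊑ relabel f e ℓ
  ⊑-relabel fe {e′} fe′ with e′ Fin.≟ e
  ... | yes refl with () ← trans (sym fe) fe′
  ... | no e′≢e  = trans (relabel-≢ e′≢e) fe′

  relabel⁻ : ∀ {e′ l} → relabel f e ℓ e′ ≡ just l → (e′ ≡ e × l ≡ ℓ) ⊎ f e′ ≡ just l
  relabel⁻ {e′} eq with e′ Fin.≟ e
  ... | yes refl = inj₁ (refl , just-injective (trans (sym eq) relabel-e))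
  ... | no e′≢e  = inj₂ (trans (sym (relabel-≢ e′≢e)) eq)

  relabel-isPartialLabeling : ∀ {S} → IsPartialLabeling S f → ℓ ∈ₗ unused S f → IsPartialLabeling S (relabel f e ℓ)
  relabel-isPartialLabeling {S} isP ℓ∈ = record { from-S = from-S′ ; distinct = distinct′ }
    where
    open IsPartialLabeling isP
    fresh : ∀ {e′ l} → f e′ ≡ just l → l ≢ ℓ
    fresh fe′ refl = proj₂ (∈-unused⁻ S f ℓ∈) (∈-mapMaybe⁺ {f = f} (∈-allFin _) fe′)
    from-S′ : ∀ e′ l → relabel f e ℓ e′ ≡ just l → l ∈ₗ S
    from-S′ e′ l eq with relabel⁻ eq
    ... | inj₁ (_ , refl) = proj₁ (∈-unused⁻ S f ℓ∈)
    ... | inj₂ fe′        = from-S e′ l fe′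
    distinct′ : ∀ e₁ e₂ l → relabel f e ℓ e₁ ≡ just l → relabel f e ℓ e₂ ≡ just l → e₁ ≡ e₂
    distinct′ e₁ e₂ l eq₁ eq₂ with relabel⁻ eq₁ | relabel⁻ eq₂
    ... | inj₁ (refl , _) | inj₁ (refl , _) = refl
    ... | inj₁ (_ , l≡ℓ)  | inj₂ fe₂        = contradiction l≡ℓ (fresh fe₂)
    ... | inj₂ fe₁        | inj₁ (_ , l≡ℓ)  = contradiction l≡ℓ (fresh fe₁)
    ... | inj₂ fe₁        | inj₂ fe₂        = distinct e₁ e₂ l fe₁ fe₂

module _ {r m : ℕ} (G : Graph r m) where
  open Graph G

  module _ {f : Fin m → Maybe ℕ} {e : Fin m} (fe : f e ≡ nothing) (ℓ : ℕ) where

    weight-relabel-∈ : ∀ {x} → x ∈ edge e → weight G (relabel f e ℓ) x ≡ ℓ + weight G f x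
    weight-relabel-∈ {x} x∈e = sum-relabel-∈ f fe ℓ
      (Unique.filter⁺ (λ e → x ∈? edge e) (Unique.allFin⁺ m)) (∈-filter⁺ _ (∈-allFin e) x∈e)

    weight-relabel-∉ : ∀ {x} → ¬ x ∈ edge e → weight G (relabel f e ℓ) x ≡ weight G f x
    weight-relabel-∉ {x} x∉e = cong sum (mapMaybe-relabel-∉ f fe ℓ (All.map
      (λ { x∈e′ refl → x∉e x∈e′ }) (All.all-filter (λ e → x ∈? edge e) (allFin m))))

  module _ (¬K₂ : ¬ IsK₂ G) {S : List ℕ} (S! : Unique S) (∣S∣ : length S ≡ m + 2) where

    label-edge : ∀ {f} e → IsPartialLabeling S f → Balanced G f →
      ∃ λ g → f ⊑ g × (∃ λ l → g e ≡ just l) × IsPartialLabeling S g × Balanced G g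
    label-edge {f} e isP bal with f e in fe
    ... | just l  = f , (λ eq → eq) , (l , fe) , isP , bal
    ... | nothing with ∣p∣≡2⇒pair (two-ends e)
    ... | u , v , u≢v , u∈e , v∈e , only
      with ℓ , ℓ∈ , safe ← safe-label (weight G f) u≢v (edge⇒3≤r G ¬K₂ e)
                             (unused-! S f S!) (3≤length-unused S f S! ∣S∣ fe) =
      relabel f e ℓ , ⊑-relabel {f = f} ℓ fe , (ℓ , relabel-e {f = f} ℓ) , relabel-isPartialLabeling ℓ isP ℓ∈ ,
      λ w 0<w → safe bumped w (bal w 0<w)
      where
      bumped : Bumped (weight G f) u≢v ℓ (weight G (relabel f e ℓ))
      bumped = record
        { at-u      = weight-relabel-∈ fe ℓ u∈e
        ; at-v      = weight-relabel-∈ fe ℓ v∈e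
        ; elsewhere = λ u≢x v≢x → weight-relabel-∉ fe ℓ λ x∈e → case only x∈e of λ where
            (inj₁ refl) → u≢x refl
            (inj₂ refl) → v≢x refl
        }

    label-edges : ∀ {f} es → IsPartialLabeling S f → Balanced G f →
      ∃ λ g → f ⊑ g × All (λ e → ∃ λ l → g e ≡ just l) es × IsPartialLabeling S g × Balanced G g
    label-edges {f} [] isP bal = f , (λ eq → eq) , [] , isP , bal
    label-edges (e ∷ es) isP bal =
      let g , f⊑g , (l , ge) , isP′ , bal′ = label-edge e isP bal
          k , g⊑k , labeled , isP″ , bal″ = label-edges es isP′ bal′
      in  k , g⊑k ∘ f⊑g , (l , g⊑k ge) ∷ labeled , isP″ , bal″

  Balanced-cong : ∀ {f g} → (∀ e → f e ≡ g e) → Balanced G f → Balanced G g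
  Balanced-cong {f} {g} f≗g bal w 0<w = ≤-trans
    (Unique-⊆⇒length≤ (class-! (weight G g) w) λ {x} x∈ → ∈-filter⁺ _ (∈-allFin x)
      (trans (cong sum (mapMaybe-cong f≗g (filter (λ e → x ∈? edge e) (allFin m)))) (proj₂ (∈-filter⁻ _ {xs = allFin r} x∈))))
    (bal w 0<w)

lemma4p2 : ∀ {r m : ℕ} (G : Graph r m) → ¬ IsK₂ G →
    (S : List ℕ) → Unique S → All (0 <_) S → length S ≡ m + 2 →
    (f : Fin m → Maybe ℕ) → IsPartialLabeling S f → Balanced G f →
    Σ (Fin m → ℕ) (λ g → IsCompletion S f g × Balanced G (just ∘ g))
lemma4p2 {m = m} G ¬K₂ S S! _ ∣S∣ f isP bal
  with k , f⊑k , labeled , isPₖ , balₖ ← label-edges G ¬K₂ S! ∣S∣ (allFin m) isP bal =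
  g , record
    { extends  = λ e l fe → just-injective (trans (sym (k≗g e)) (f⊑k fe))
    ; from-S   = λ e _ → from-S e (g e) (k≗g e)
    ; unused   = λ e fe e′ fe′ → case distinct e e′ (g e) (k≗g e) (f⊑k fe′) of λ where
        refl → case trans (sym fe) fe′ of λ ()
    ; distinct = λ e e′ _ _ ge≡ge′ → distinct e e′ (g e) (k≗g e) (trans (k≗g e′) (cong just (sym ge≡ge′)))
    } , Balanced-cong G k≗g balₖ
  where
  open IsPartialLabeling isPₖ
  g : Fin m → ℕ
  g e = proj₁ (All.lookup labeled (∈-allFin e))
  k≗g : ∀ e → k e ≡ just (g e)
  k≗g e = proj₂ (All.lookup labeled (∈-allFin e))
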